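{- Let $NA(n,k)=\frac{1}{k+1}\binom{n+1}{k}\binom{n}{k}$ and $NB(n,k)=\binom{n}{k}^2$. Then the infinite matrices $$N_A^{\square}=[NA(n+k,k)]_{n,k\geq 0}\quad\text{and}\quad N_B^{\square}=[NB(n+k,k)]_{n,k\geq 0}$$ are strictly totally positive.
   Context: A (finite or infinite) real matrix is strictly totally positive (STP) if all of its minors are positive. -}

module Defs where

open import Data.Nat using (ℕ; zero; suc; _+_; _*_)
open import Data.Nat.Combinatorics using (_C_)
open import Data.Fin using (Fin; zero; suc; toℕ; punchIn)
import Data.Fin as F
import Data.Nat as N
open import Data.Integer using (+_)
open import Data.Rational using (ℚ; 0ℚ; 1ℚ; _/_; _<_)
import Data.Rational as Q

Σᶠ : ∀ m → (Fin m → ℚ) → ℚ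
Σᶠ zero    f = 0ℚ
Σᶠ (suc m) f = f zero Q.+ Σᶠ m (λ i → f (suc i))

sgn : ℕ → ℚ
sgn zero    = 1ℚ
sgn (suc n) = Q.- sgn n

det : ∀ m → (Fin m → Fin m → ℚ) → ℚ
det zero    A = 1ℚ
det (suc m) A =
  Σᶠ (suc m) (λ j → sgn (toℕ j) Q.* (A zero j Q.* det m (λ r c → A (suc r) (punchIn j c))))

StrictlyIncreasing : ∀ {m} → (Fin m → ℕ) → Set
StrictlyIncreasing {m} r = ∀ (i j : Fin m) → i F.< j → r i N.< r j

StrictlyTotallyPositive : (ℕ → ℕ → ℚ) → Set
StrictlyTotallyPositive M =
  ∀ m (r c : Fin m → ℕ) → StrictlyIncreasing r → StrictlyIncreasing c →
  0ℚ < det m (λ i j → M (r i) (c j))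

NA : ℕ → ℕ → ℚ
NA n k = (+ (((suc n) C k) * (n C k))) / suc k

NB : ℕ → ℕ → ℚ
NB n k = (+ ((n C k) * (n C k))) / 1

NAsq : ℕ → ℕ → ℚ
NAsq n k = NA (n + k) k

NBsq : ℕ → ℕ → ℚ
NBsq n k = NB (n + k) k

{-# OPTIONS --safe #-}
module Submission where

-- In terms of the node z = n + ½, column k of each matrix is a positive multiple of the product of
-- (z + a_q)(z + b_q) over q < k, with all a_q and b_q positive.  Start from the powers of z and, for
-- q = 0, 1, 2, …, first replace one factor z of every column after the q-th by (z + a_q), then
-- multiply these columns by (z + b_q).  The replacement adds to each column a multiple of the column
-- before it, since (z + a) z^i = z^(i+1) + a z^i; the multiplication scales it and adds the column
-- after it, since (z + a)(z + b) z^i = b (z + a) z^i + (z + a) z^(i+1).  Both keep all minors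
-- positive, so positivity is inherited from the generalised Vandermonde matrix of the powers.  The
-- latter is treated in the same way: subtracting the smallest node from all nodes makes the first
-- row (1, 0, …, 0), and replacements z ↦ z + a undo the subtraction.

open import Defs
open import Data.Fin using (Fin; zero; suc; toℕ; punchIn; punchOut; inject₁)
import Data.Fin as F
open import Data.Fin.Properties
  using (_≟_; toℕ-inject₁; punchIn-punchOut; punchIn-injective; any?)
import Data.Fin.Properties as Fₚ
open import Data.Integer using (+_)
import Data.Integer as ℤ
import Data.Integer.Properties as ℤₚ
open import Data.List using (List; []; _∷_; _∷ʳ_; applyUpTo)
open import Data.List.Properties using (applyUpTo-∷ʳ)
open import Data.Nat using (ℕ; zero; suc; pred; z≤n; s≤s; _!)
import Data.Nat as ℕ
import Data.Nat.Properties as ℕₚ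
open import Data.Nat.Combinatorics using (_C_; nCk≡n!/k![n-k]!; k![n∸k]!∣n!)
open import Data.Nat.DivMod using (m/n*n≡m)
open import Data.Product using (_×_; _,_; ∃-syntax)
open import Data.Rational hiding (_≟_)
open import Data.Rational.Properties hiding (_≟_)
import Data.Rational.Unnormalised as ℚᵘ
import Data.Rational.Unnormalised.Properties as ℚᵘₚ
open import Data.Rational.Unnormalised using (mkℚᵘ)
open import Data.Rational.Solver using (module +-*-Solver)
open import Data.Sum using (_⊎_; inj₁; inj₂)
open import Data.Unit using (⊤; tt)
open import Data.Vec.Functional using () renaming (_∷_ to _◂_)
open import Function using (_∘_)
open import Relation.Nullary using (yes; no; contradiction)
open import Relation.Binary.PropositionalEquality
open +-*-Solver using (solve; _:=_; _:+_; _:*_; :-_; con)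

-- Finite sums

Σᶠ-cong : ∀ {m} {f g : Fin m → ℚ} → (∀ j → f j ≡ g j) → Σᶠ m f ≡ Σᶠ m g
Σᶠ-cong {zero}  f≗g = refl
Σᶠ-cong {suc m} f≗g = cong₂ _+_ (f≗g zero) (Σᶠ-cong (f≗g ∘ suc))

Σᶠ-linear : ∀ {m} a b {f g h : Fin m → ℚ} → (∀ j → f j ≡ a * g j + b * h j) →
            Σᶠ m f ≡ a * Σᶠ m g + b * Σᶠ m h
Σᶠ-linear {zero}  a b eq = solve 2 (λ a b → con 0ℚ := a :* con 0ℚ :+ b :* con 0ℚ) refl a b
Σᶠ-linear {suc m} a b {f} {g} {h} eq =
  trans (cong₂ _+_ (eq zero) (Σᶠ-linear a b (eq ∘ suc)))
    (solve 6 (λ a b g h G H → (a :* g :+ b :* h) :+ (a :* G :+ b :* H)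
                            := a :* (g :+ G) :+ b :* (h :+ H))
      refl a b (g zero) (h zero) (Σᶠ m (g ∘ suc)) (Σᶠ m (h ∘ suc)))

Σᶠ-scale : ∀ {m} a {f g : Fin m → ℚ} → (∀ j → f j ≡ a * g j) → Σᶠ m f ≡ a * Σᶠ m g
Σᶠ-scale {zero}  a eq = sym (*-zeroʳ a)
Σᶠ-scale {suc m} a eq =
  trans (cong₂ _+_ (eq zero) (Σᶠ-scale a (eq ∘ suc))) (sym (*-distribˡ-+ a _ _))

Σᶠ-zero : ∀ {m} {f : Fin m → ℚ} → (∀ j → f j ≡ 0ℚ) → Σᶠ m f ≡ 0ℚ
Σᶠ-zero {zero}  f≗0 = refl
Σᶠ-zero {suc m} f≗0 = cong₂ _+_ (f≗0 zero) (Σᶠ-zero (f≗0 ∘ suc))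

-- Meant for the first-row expansion of a matrix with two equal neighbouring columns: the terms at
-- those two columns cancel and all others vanish.
Σᶠ-adjacent-cancel : ∀ {m} (s : Fin m) {f : Fin (suc m) → ℚ} →
  f (inject₁ s) + f (suc s) ≡ 0ℚ →
  (∀ j → j ≢ inject₁ s → j ≢ suc s → f j ≡ 0ℚ) → Σᶠ (suc m) f ≡ 0ℚ
Σᶠ-adjacent-cancel {suc m} zero {f} cancel vanish = begin
  f zero + (f (suc zero) + Σᶠ m (λ j → f (suc (suc j)))) ≡⟨ +-assoc (f zero) _ _ ⟨
  f zero + f (suc zero) + Σᶠ m (λ j → f (suc (suc j)))
    ≡⟨ cong₂ _+_ cancel (Σᶠ-zero (λ j → vanish (suc (suc j)) (λ ()) (λ ()))) ⟩
  0ℚ ∎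
  where open ≡-Reasoning
Σᶠ-adjacent-cancel {suc m} (suc s) {f} cancel vanish =
  cong₂ _+_ (vanish zero (λ ()) (λ ()))
    (Σᶠ-adjacent-cancel s cancel
      (λ j p q → vanish (suc j) (p ∘ Fₚ.suc-injective) (q ∘ Fₚ.suc-injective)))

-- Determinants as functions of their columns

det-cong : ∀ {m} {A B : Fin m → Fin m → ℚ} → (∀ i j → A i j ≡ B i j) → det m A ≡ det m B
det-cong {zero}  A≗B = refl
det-cong {suc m} A≗B = Σᶠ-cong λ j →
  cong (sgn (toℕ j) *_) (cong₂ _*_ (A≗B zero j) (det-cong (λ r c → A≗B (suc r) (punchIn j c))))

-- Induction on the size through the first-row expansion. The term at column `t` is linear through
-- its entry, since its minor omits that column; every other term is linear through its minor, by
-- induction.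
det-linear : ∀ {m} (t : Fin m) a b {X Y Z : Fin m → Fin m → ℚ} →
  (∀ i → X i t ≡ a * Y i t + b * Z i t) →
  (∀ i j → j ≢ t → X i j ≡ Y i j) → (∀ i j → j ≢ t → X i j ≡ Z i j) →
  det m X ≡ a * det m Y + b * det m Z
det-linear {suc m} t a b {X} {Y} {Z} X≡aY+bZ X≡Y X≡Z = Σᶠ-linear a b term
  where
  open ≡-Reasoning
  minor : (Fin (suc m) → Fin (suc m) → ℚ) → Fin (suc m) → ℚ
  minor A j = det m (λ r c → A (suc r) (punchIn j c))
  term : ∀ j → sgn (toℕ j) * (X zero j * minor X j) ≡
    a * (sgn (toℕ j) * (Y zero j * minor Y j)) + b * (sgn (toℕ j) * (Z zero j * minor Z j))
  term j with j ≟ t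
  ... | yes refl = begin
    sgn (toℕ j) * (X zero j * minor X j)
      ≡⟨ cong (λ x → sgn (toℕ j) * (x * minor X j)) (X≡aY+bZ zero) ⟩
    sgn (toℕ j) * ((a * Y zero j + b * Z zero j) * minor X j)
      ≡⟨ solve 6 (λ s a b y z d → s :* ((a :* y :+ b :* z) :* d)
            := a :* (s :* (y :* d)) :+ b :* (s :* (z :* d)))
          refl (sgn (toℕ j)) a b (Y zero j) (Z zero j) (minor X j) ⟩
    a * (sgn (toℕ j) * (Y zero j * minor X j)) + b * (sgn (toℕ j) * (Z zero j * minor X j))
      ≡⟨ cong₂ (λ u v → a * (sgn (toℕ j) * (Y zero j * u)) + b * (sgn (toℕ j) * (Z zero j * v)))
          (det-cong (λ r c → X≡Y (suc r) (punchIn j c) (Fₚ.punchInᵢ≢i j c)))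
          (det-cong (λ r c → X≡Z (suc r) (punchIn j c) (Fₚ.punchInᵢ≢i j c))) ⟩
    a * (sgn (toℕ j) * (Y zero j * minor Y j)) + b * (sgn (toℕ j) * (Z zero j * minor Z j)) ∎
  ... | no j≢t = begin
    sgn (toℕ j) * (X zero j * minor X j)
      ≡⟨ cong (λ x → sgn (toℕ j) * (X zero j * x)) minor-linear ⟩
    sgn (toℕ j) * (X zero j * (a * minor Y j + b * minor Z j))
      ≡⟨ solve 6 (λ s a b x y z → s :* (x :* (a :* y :+ b :* z))
            := a :* (s :* (x :* y)) :+ b :* (s :* (x :* z)))
          refl (sgn (toℕ j)) a b (X zero j) (minor Y j) (minor Z j) ⟩
    a * (sgn (toℕ j) * (X zero j * minor Y j)) + b * (sgn (toℕ j) * (X zero j * minor Z j))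
      ≡⟨ cong₂ (λ u v → a * (sgn (toℕ j) * (u * minor Y j)) + b * (sgn (toℕ j) * (v * minor Z j)))
          (X≡Y zero j j≢t) (X≡Z zero j j≢t) ⟩
    a * (sgn (toℕ j) * (Y zero j * minor Y j)) + b * (sgn (toℕ j) * (Z zero j * minor Z j)) ∎
    where
    -- The position that column `t` takes once column `j` is deleted.
    t′ : Fin m
    t′ = punchOut j≢t
    avoid : ∀ c → c ≢ t′ → punchIn j c ≢ t
    avoid c c≢t′ eq = c≢t′ (punchIn-injective j c t′ (trans eq (sym (punchIn-punchOut j≢t))))
    minor-linear : minor X j ≡ a * minor Y j + b * minor Z j
    minor-linear = det-linear t′ a b
      (λ i → subst (λ u → X (suc i) u ≡ a * Y (suc i) u + b * Z (suc i) u)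
               (sym (punchIn-punchOut j≢t)) (X≡aY+bZ (suc i)))
      (λ i c c≢t′ → X≡Y (suc i) (punchIn j c) (avoid c c≢t′))
      (λ i c c≢t′ → X≡Z (suc i) (punchIn j c) (avoid c c≢t′))

-- Deleting one or the other of two neighbouring columns leaves the same list, except at the one
-- place where the survivor of the pair stands. With equal neighbours the two minors therefore
-- coincide.
punchIn-adjacent : ∀ {m} (s c : Fin m) →
  punchIn (inject₁ s) c ≡ punchIn (suc s) c ⊎
  (punchIn (inject₁ s) c ≡ suc s × punchIn (suc s) c ≡ inject₁ s)
punchIn-adjacent zero    zero    = inj₂ (refl , refl)
punchIn-adjacent zero    (suc c) = inj₁ refl
punchIn-adjacent (suc s) zero    = inj₁ refl
punchIn-adjacent (suc s) (suc c) with punchIn-adjacent s c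
... | inj₁ eq        = inj₁ (cong suc eq)
... | inj₂ (eq , eq′) = inj₂ (cong suc eq , cong suc eq′)

-- Deleting a column outside a neighbouring pair leaves the pair neighbouring, so the induction in
-- `det-adjacent-equal` reaches that minor.
adjacent-preimage : ∀ {m} (j : Fin (suc (suc m))) (s : Fin (suc m)) →
  j ≢ inject₁ s → j ≢ suc s →
  ∃[ s′ ] punchIn j (inject₁ s′) ≡ inject₁ s × punchIn j (suc s′) ≡ suc s
adjacent-preimage zero          zero    p q = contradiction refl p
adjacent-preimage zero          (suc s) p q = s , refl , refl
adjacent-preimage (suc zero)    zero    p q = contradiction refl q
adjacent-preimage {suc m} (suc (suc j)) zero p q = zero , refl , refl
adjacent-preimage {suc m} (suc j) (suc s) p q
  with adjacent-preimage j s (p ∘ cong suc) (q ∘ cong suc)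
... | s′ , eq , eq′ = suc s′ , cong suc eq , cong suc eq′

-- In the first-row expansion the two terms at the equal columns have the same entry and minor but
-- opposite signs. Every other minor still contains both columns and vanishes by induction.
det-adjacent-equal : ∀ {m} (s : Fin m) {A : Fin (suc m) → Fin (suc m) → ℚ} →
  (∀ i → A i (inject₁ s) ≡ A i (suc s)) → det (suc m) A ≡ 0ℚ
det-adjacent-equal {suc m} s {A} eq = Σᶠ-adjacent-cancel s cancel vanish
  where
  open ≡-Reasoning
  minor : Fin (suc (suc m)) → ℚ
  minor j = det (suc m) (λ r c → A (suc r) (punchIn j c))
  minor-eq : minor (inject₁ s) ≡ minor (suc s)
  minor-eq = det-cong entry
    where
    entry : ∀ r c → A (suc r) (punchIn (inject₁ s) c) ≡ A (suc r) (punchIn (suc s) c)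
    entry r c with punchIn-adjacent s c
    ... | inj₁ p       = cong (A (suc r)) p
    ... | inj₂ (p , q) =
      trans (cong (A (suc r)) p) (trans (sym (eq (suc r))) (cong (A (suc r)) (sym q)))
  cancel : sgn (toℕ (inject₁ s)) * (A zero (inject₁ s) * minor (inject₁ s)) +
           - sgn (toℕ s) * (A zero (suc s) * minor (suc s)) ≡ 0ℚ
  cancel = begin
    sgn (toℕ (inject₁ s)) * (A zero (inject₁ s) * minor (inject₁ s)) +
      - sgn (toℕ s) * (A zero (suc s) * minor (suc s))
      ≡⟨ cong (_+ - sgn (toℕ s) * (A zero (suc s) * minor (suc s)))
           (cong₂ _*_ (cong sgn (toℕ-inject₁ s)) (cong₂ _*_ (eq zero) minor-eq)) ⟩
    sgn (toℕ s) * (A zero (suc s) * minor (suc s)) +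
      - sgn (toℕ s) * (A zero (suc s) * minor (suc s))
      ≡⟨ solve 2 (λ s x → s :* x :+ (:- s) :* x := con 0ℚ) refl
           (sgn (toℕ s)) (A zero (suc s) * minor (suc s)) ⟩
    0ℚ ∎
  vanish : ∀ j → j ≢ inject₁ s → j ≢ suc s → sgn (toℕ j) * (A zero j * minor j) ≡ 0ℚ
  vanish j p q with adjacent-preimage j s p q
  ... | s′ , e , e′ = begin
    sgn (toℕ j) * (A zero j * minor j)
      ≡⟨ cong (λ d → sgn (toℕ j) * (A zero j * d)) (det-adjacent-equal s′ {λ r c → A (suc r) (punchIn j c)} λ i →
           trans (cong (A (suc i)) e) (trans (eq (suc i)) (cong (A (suc i)) (sym e′)))) ⟩
    sgn (toℕ j) * (A zero j * 0ℚ)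
      ≡⟨ solve 2 (λ s x → s :* (x :* con 0ℚ) := con 0ℚ) refl (sgn (toℕ j)) (A zero j) ⟩
    0ℚ ∎

-- Positive products and row reductions

positive-* : ∀ {p q} → 0ℚ < p → 0ℚ < q → 0ℚ < p * q
positive-* {p} {q} 0<p 0<q = positive⁻¹ (p * q) {{pos*pos⇒pos p {{positive 0<p}} q {{positive 0<q}}}}

nonNegative-* : ∀ {p q} → 0ℚ ≤ p → 0ℚ ≤ q → 0ℚ ≤ p * q
nonNegative-* {p} {q} 0≤p 0≤q =
  nonNegative⁻¹ (p * q) {{nonNeg*nonNeg⇒nonNeg p {{nonNegative 0≤p}} q {{nonNegative 0≤q}}}}

Πᶠ : ∀ {m} → (Fin m → ℚ) → ℚ
Πᶠ {zero}  d = 1ℚ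
Πᶠ {suc m} d = d zero * Πᶠ (d ∘ suc)

Πᶠ-positive : ∀ {m} {d : Fin m → ℚ} → (∀ i → 0ℚ < d i) → 0ℚ < Πᶠ d
Πᶠ-positive {zero}  0<d = positive⁻¹ 1ℚ
Πᶠ-positive {suc m} 0<d = positive-* (0<d zero) (Πᶠ-positive (0<d ∘ suc))

det-scaleRows : ∀ {m} (d : Fin m → ℚ) {A B : Fin m → Fin m → ℚ} →
  (∀ i j → A i j ≡ d i * B i j) → det m A ≡ Πᶠ d * det m B
det-scaleRows {zero}  d A≡dB = refl
det-scaleRows {suc m} d {A} {B} A≡dB = Σᶠ-scale (Πᶠ d) λ j →
  let e = Πᶠ (d ∘ suc)
      minor = det m (λ r c → B (suc r) (punchIn j c)) in
  trans (cong (sgn (toℕ j) *_)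
          (cong₂ _*_ (A≡dB zero j) (det-scaleRows (d ∘ suc) (λ r c → A≡dB (suc r) (punchIn j c)))))
    (solve 5 (λ s x b e n → s :* ((x :* b) :* (e :* n)) := (x :* e) :* (s :* (b :* n)))
      refl (sgn (toℕ j)) (d zero) (B zero j) e minor)

det-firstRow : ∀ {m} {A : Fin (suc m) → Fin (suc m) → ℚ} →
  A zero zero ≡ 1ℚ → (∀ j → A zero (suc j) ≡ 0ℚ) →
  det (suc m) A ≡ det m (λ i j → A (suc i) (suc j))
det-firstRow {m} {A} eq₁ eq₀ = begin
  1ℚ * (A zero zero * M) + Σᶠ m (λ j → sgn (toℕ (suc j)) * (A zero (suc j) * N j))
    ≡⟨ cong₂ _+_ (cong (λ x → 1ℚ * (x * M)) eq₁) (Σᶠ-zero λ j →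
         trans (cong (λ x → sgn (toℕ (suc j)) * (x * N j)) (eq₀ j))
           (solve 2 (λ s x → s :* (con 0ℚ :* x) := con 0ℚ) refl (sgn (toℕ (suc j))) (N j))) ⟩
  1ℚ * (1ℚ * M) + 0ℚ ≡⟨ solve 1 (λ x → con 1ℚ :* (con 1ℚ :* x) :+ con 0ℚ := x) refl M ⟩
  M ∎
  where
  open ≡-Reasoning
  M : ℚ
  M = det m (λ i j → A (suc i) (suc j))
  N : Fin m → ℚ
  N j = det m (λ r c → A (suc r) (punchIn (suc j) c))

-- Positivity by multilinear expansion

-- The number `m` of vectors is kept apart from their length `n`, because fixing the first vector
-- lowers only `m`. Vectors are indexed first, so that `X j` is column `j` of a matrix.
record Multilinear {m n} (D : (Fin m → Fin n → ℚ) → ℚ) : Set where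
  field
    respects : ∀ {X Y} → (∀ j i → X j i ≡ Y j i) → D X ≡ D Y
    linear   : ∀ t a b {X Y Z} → (∀ i → X t i ≡ a * Y t i + b * Z t i) →
               (∀ j → j ≢ t → ∀ i → X j i ≡ Y j i) → (∀ j → j ≢ t → ∀ i → X j i ≡ Z j i) →
               D X ≡ a * D Y + b * D Z

det-multilinear : ∀ {m} → Multilinear {m} (λ X → det m (λ i j → X j i))
det-multilinear = record
  { respects = λ X≗Y → det-cong (λ i j → X≗Y j i)
  ; linear   = λ t a b p q r →
      det-linear t a b p (λ i j j≢t → q j j≢t i) (λ i j j≢t → r j j≢t i)
  }

-- Full expansion gives one term for each choice of `u j` or `v j`, all nonnegative. The term taking
-- `u` throughout is positive, as its coefficient is the product of the `α j`. The induction expands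
-- the first column and then treats `D` with that column fixed as a function of the rest.
multilinear-positive : ∀ {I : Set} {m n} {D : (Fin m → Fin n → ℚ) → ℚ} → Multilinear D →
  (F : I → Fin n → ℚ) (u v : Fin m → I) (α β : Fin m → ℚ) (X : Fin m → Fin n → ℚ) →
  (∀ j → 0ℚ < α j) → (∀ j → 0ℚ ≤ β j) →
  (∀ j i → X j i ≡ α j * F (u j) i + β j * F (v j) i) →
  (∀ d → (∀ j → d j ≡ u j ⊎ d j ≡ v j) → 0ℚ ≤ D (F ∘ d)) →
  0ℚ < D (F ∘ u) → 0ℚ < D X
multilinear-positive {m = zero} D-ml F u v α β X 0<α 0≤β eq nonneg pos =
  subst (0ℚ <_) (Multilinear.respects D-ml λ ()) pos
multilinear-positive {I} {suc m} {n} {D} D-ml F u v α β X 0<α 0≤β eq nonneg pos =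
  -- `X zero ◂ (X ∘ suc)` agrees with `X` only pointwise, hence the appeal to `respects`.
  subst (0ℚ <_) (respects λ { zero _ → refl ; (suc _) _ → refl })
    (multilinear-positive tail-multilinear F (u ∘ suc) (v ∘ suc) (α ∘ suc) (β ∘ suc) (X ∘ suc)
      (0<α ∘ suc) (0≤β ∘ suc) (eq ∘ suc) tail-nonneg tail-pos)
  where
  open Multilinear D-ml
  tail-multilinear : Multilinear (λ Y → D (X zero ◂ Y))
  tail-multilinear = record
    { respects = λ Y≗Z → respects λ { zero i → refl ; (suc j) i → Y≗Z j i }
    ; linear   = λ t a b p q r → linear (suc t) a b p
        (λ { zero _ _ → refl ; (suc j) ne i → q j (ne ∘ cong suc) i })
        (λ { zero _ _ → refl ; (suc j) ne i → r j (ne ∘ cong suc) i })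
    }
  split : ∀ d → D (X zero ◂ (F ∘ d)) ≡ α zero * D (F ∘ (u zero ◂ d)) + β zero * D (F ∘ (v zero ◂ d))
  split d = linear zero (α zero) (β zero) (eq zero)
    (λ { zero ne _ → contradiction refl ne ; (suc j) _ i → refl })
    (λ { zero ne _ → contradiction refl ne ; (suc j) _ i → refl })
  tail-nonneg : ∀ d → (∀ j → d j ≡ u (suc j) ⊎ d j ≡ v (suc j)) → 0ℚ ≤ D (X zero ◂ (F ∘ d))
  tail-nonneg d choice = subst (0ℚ ≤_) (sym (split d))
    (+-mono-≤
      (nonNegative-* (<⇒≤ (0<α zero)) (nonneg (u zero ◂ d) λ { zero → inj₁ refl ; (suc j) → choice j }))
      (nonNegative-* (0≤β zero) (nonneg (v zero ◂ d) λ { zero → inj₂ refl ; (suc j) → choice j })))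
  tail-pos : 0ℚ < D (X zero ◂ (F ∘ (u ∘ suc)))
  tail-pos = subst (0ℚ <_) (sym (split (u ∘ suc)))
    (+-mono-<-≤
      (positive-* (0<α zero) (subst (0ℚ <_) (respects λ { zero i → refl ; (suc j) i → refl }) pos))
      (nonNegative-* (0≤β zero)
        (nonneg (v zero ◂ (u ∘ suc)) λ { zero → inj₂ refl ; (suc j) → inj₁ refl })))

adjacent⇒strictlyIncreasing : ∀ {m} (d : Fin (suc m) → ℕ) →
  (∀ s → d (inject₁ s) ℕ.< d (suc s)) → StrictlyIncreasing d
adjacent⇒strictlyIncreasing {suc m} d step zero (suc zero) _ = step zero
adjacent⇒strictlyIncreasing {suc m} d step zero (suc (suc j)) _ =
  ℕₚ.<-trans (step zero)
    (adjacent⇒strictlyIncreasing (d ∘ suc) (step ∘ suc) zero (suc j) (s≤s z≤n))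
adjacent⇒strictlyIncreasing {suc m} d step (suc i) (suc j) (s≤s i<j) =
  adjacent⇒strictlyIncreasing (d ∘ suc) (step ∘ suc) i j i<j

-- A weakly increasing tuple either repeats an index at neighbouring places, which makes the
-- determinant zero, or is strictly increasing.
sorted-columns-nonNegative : ∀ {m} (F : ℕ → Fin m → ℚ) (d : Fin m → ℕ) →
  (∀ {i j} → i F.< j → d i ℕ.≤ d j) →
  (StrictlyIncreasing d → 0ℚ < det m (λ i j → F (d j) i)) → 0ℚ ≤ det m (λ i j → F (d j) i)
sorted-columns-nonNegative {zero}  F d sorted pos = <⇒≤ (pos λ ())
sorted-columns-nonNegative {suc m} F d sorted pos with any? (λ s → d (inject₁ s) ℕ.≟ d (suc s))
... | yes (s , eq) = ≤-reflexive (sym (det-adjacent-equal s {λ i j → F (d j) i} (λ i → cong (λ k → F k i) eq)))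
... | no distinct = <⇒≤ (pos (adjacent⇒strictlyIncreasing d λ s →
  ℕₚ.≤∧≢⇒< (sorted (s≤s (ℕₚ.≤-reflexive (toℕ-inject₁ s)))) (λ eq → distinct (s , eq))))

-- Column operations that preserve positive minors

-- The rows are already selected in `F`; only column tuples vary. The predicate `P` restricts the
-- tuples in the Vandermonde induction, where only those starting at 0 give positive minors.
PositiveMinors : ∀ {m} → ((Fin m → ℕ) → Set) → (ℕ → Fin m → ℚ) → Set
PositiveMinors {m} P F = ∀ c → StrictlyIncreasing c → P c → 0ℚ < det m (λ i j → F (c j) i)

-- Guarantees that the expansion of a minor never produces columns out of order, so no negative sign
-- can arise from sorting them.
Interlacing : (ℕ → ℕ) → Set
Interlacing ν = ∀ {k l x y} → k ℕ.< l → x ≡ k ⊎ x ≡ ν k → y ≡ l ⊎ y ≡ ν l → x ℕ.≤ y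

Stable : ∀ {m} → (ℕ → ℕ) → ((Fin m → ℕ) → Set) → Set
Stable ν P = ∀ {c d} → (∀ j → d j ≡ c j ⊎ d j ≡ ν (c j)) → P c → P d

-- `α` must be strictly positive because the minor of `F` at the original indices carries the
-- positivity; the neighbour's coefficient `β` may be zero.
record CombinationAt {m} (ν : ℕ → ℕ) (F G : ℕ → Fin m → ℚ) (k : ℕ) : Set where
  constructor combine
  field
    α β  : ℚ
    0<α  : 0ℚ < α
    0≤β  : 0ℚ ≤ β
    expr : ∀ i → G k i ≡ α * F k i + β * F (ν k) i

Combination : ∀ {m} → (ℕ → ℕ) → (F G : ℕ → Fin m → ℚ) → Set
Combination ν F G = ∀ k → CombinationAt ν F G k

-- Expanding a minor of G multilinearly gives nonnegative multiples of determinants whose column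
-- indices are weakly increasing: these are minors of F or have two equal columns.
combination-positive : ∀ {m} {P : (Fin m → ℕ) → Set} {ν} {F G : ℕ → Fin m → ℚ} →
  Interlacing ν → Stable ν P → Combination ν F G → PositiveMinors P F → PositiveMinors P G
combination-positive {ν = ν} {F} {G} interlacing stable comb pos c c-inc Pc =
  multilinear-positive det-multilinear F c (ν ∘ c)
    (α ∘ comb ∘ c) (β ∘ comb ∘ c) (G ∘ c) (0<α ∘ comb ∘ c) (0≤β ∘ comb ∘ c) (expr ∘ comb ∘ c)
    (λ d choice → sorted-columns-nonNegative F d
      (λ {i} {j} i<j → interlacing (c-inc i j i<j) (choice i) (choice j))
      (λ d-inc → pos d d-inc (stable choice Pc)))
    (pos c c-inc Pc)
  where open CombinationAt

pred-interlacing : Interlacing pred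
pred-interlacing {k} k<l x y = ℕₚ.≤-trans (upper x) (ℕₚ.≤-trans (ℕₚ.<⇒≤pred k<l) (lower y))
  where
  upper : ∀ {k x} → x ≡ k ⊎ x ≡ pred k → x ℕ.≤ k
  upper (inj₁ refl) = ℕₚ.≤-refl
  upper (inj₂ refl) = ℕₚ.pred[n]≤n
  lower : ∀ {l y} → y ≡ l ⊎ y ≡ pred l → pred l ℕ.≤ y
  lower (inj₁ refl) = ℕₚ.pred[n]≤n
  lower (inj₂ refl) = ℕₚ.≤-refl

suc-interlacing : Interlacing suc
suc-interlacing k<l x y = ℕₚ.≤-trans (upper x) (ℕₚ.≤-trans k<l (lower y))
  where
  upper : ∀ {k x} → x ≡ k ⊎ x ≡ suc k → x ℕ.≤ suc k
  upper (inj₁ refl) = ℕₚ.n≤1+n _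
  upper (inj₂ refl) = ℕₚ.≤-refl
  lower : ∀ {l y} → y ≡ l ⊎ y ≡ suc l → l ℕ.≤ y
  lower (inj₁ refl) = ℕₚ.≤-refl
  lower (inj₂ refl) = ℕₚ.n≤1+n _

id-interlacing : Interlacing (λ k → k)
id-interlacing k<l (inj₁ refl) (inj₁ refl) = ℕₚ.<⇒≤ k<l
id-interlacing k<l (inj₁ refl) (inj₂ refl) = ℕₚ.<⇒≤ k<l
id-interlacing k<l (inj₂ refl) (inj₁ refl) = ℕₚ.<⇒≤ k<l
id-interlacing k<l (inj₂ refl) (inj₂ refl) = ℕₚ.<⇒≤ k<l

-- Columns built from prescribed factors

-- An intermediate stage of the construction: the listed factors come first, and once the list is
-- exhausted each further factor is a plain `z`. The empty list thus gives the powers.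
column : List (ℚ → ℚ) → ℕ → ℚ → ℚ
column gs       zero    z = 1ℚ
column []       (suc k) z = z * column [] k z
column (g ∷ gs) (suc k) z = g z * column gs k z

Columns : ∀ {m} → (Fin m → ℚ) → List (ℚ → ℚ) → ℕ → Fin m → ℚ
Columns z gs k i = column gs k (z i)

unchanged : ∀ {m} {F G : ℕ → Fin m → ℚ} {ν k} → (∀ i → G k i ≡ F k i) → CombinationAt ν F G k
unchanged {F = F} {ν = ν} {k} eq = combine 1ℚ 0ℚ (positive⁻¹ 1ℚ) ≤-refl λ i →
  trans (eq i) (solve 2 (λ x y → x := con 1ℚ :* x :+ con 0ℚ :* y) refl (F k i) (F (ν k) i))

-- Passes a combination under a common leading factor. The indices on both sides are independent
-- because prepending a factor shifts the columns by one.
multiply : ∀ {m} {F G F′ G′ : ℕ → Fin m → ℚ} {ν ν′ k k′} (g : Fin m → ℚ) →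
  (∀ i → G′ k′ i ≡ g i * G k i) → (∀ i → F′ k′ i ≡ g i * F k i) →
  (∀ i → F′ (ν′ k′) i ≡ g i * F (ν k) i) → CombinationAt ν F G k → CombinationAt ν′ F′ G′ k′
multiply {F = F} {ν = ν} {k = k} g G-eq F-eq νF-eq (combine α β 0<α 0≤β expr) =
  combine α β 0<α 0≤β λ i → trans (G-eq i) (trans (cong (g i *_) (expr i)) (trans
    (solve 5 (λ g a b x y → g :* (a :* x :+ b :* y) := a :* (g :* x) :+ b :* (g :* y))
      refl (g i) α β (F k i) (F (ν k) i))
    (sym (cong₂ (λ x y → α * x + β * y) (F-eq i) (νF-eq i)))))

column-append : ∀ {m} (z : Fin m → ℚ) gs {a} → 0ℚ ≤ a →
  Combination pred (Columns z gs) (Columns z (gs ∷ʳ (_+ a)))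
column-append z gs       0≤a zero          = unchanged λ _ → refl
column-append z []       {a} 0≤a (suc k)   = combine 1ℚ a (positive⁻¹ 1ℚ) 0≤a λ i →
  solve 3 (λ z a x → (z :+ a) :* x := con 1ℚ :* (z :* x) :+ a :* x) refl (z i) a (column [] k (z i))
-- Treated apart from larger indices: `pred 1` is 0, and column 0 does not contain the factor `g`.
column-append z (g ∷ gs) 0≤a (suc zero)    = unchanged λ _ → refl
column-append z (g ∷ gs) 0≤a (suc (suc k)) =
  multiply (g ∘ z) (λ _ → refl) (λ _ → refl) (λ _ → refl) (column-append z gs 0≤a (suc k))

-- Here the column itself gets the coefficient `b` and its successor the coefficient 1, so `b` has
-- to be positive, whereas the shift in `column-append` multiplies the neighbour and need only be
-- nonnegative.
column-extendLast : ∀ {m} (z : Fin m → ℚ) gs h {b} → 0ℚ < b →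
  Combination suc (Columns z (gs ∷ʳ h)) (Columns z (gs ∷ʳ (λ x → h x * (x + b))))
column-extendLast z gs       h 0<b zero        = unchanged λ _ → refl
column-extendLast z []       h {b} 0<b (suc k) = combine b 1ℚ 0<b (<⇒≤ (positive⁻¹ 1ℚ)) λ i →
  solve 4 (λ z b h x → (h :* (z :+ b)) :* x := b :* (h :* x) :+ con 1ℚ :* (h :* (z :* x)))
    refl (z i) b (h (z i)) (column [] k (z i))
column-extendLast z (g ∷ gs) h 0<b (suc k) =
  multiply (g ∘ z) (λ _ → refl) (λ _ → refl) (λ _ → refl) (column-extendLast z gs h 0<b k)

∏ : (ℕ → ℚ → ℚ) → ℕ → ℚ → ℚ
∏ g zero    z = 1ℚ
∏ g (suc k) z = g 0 z * ∏ (g ∘ suc) k z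

column-applyUpTo : ∀ g {k p} z → k ℕ.≤ p → column (applyUpTo g p) k z ≡ ∏ g k z
column-applyUpTo g z z≤n       = refl
column-applyUpTo g z (s≤s k≤p) = cong (g 0 z *_) (column-applyUpTo (g ∘ suc) z k≤p)

bounded : ∀ {m} (c : Fin m → ℕ) → ∃[ N ] ∀ j → c j ℕ.≤ N
bounded {zero}  c = 0 , λ ()
bounded {suc m} c with bounded (c ∘ suc)
... | N , c≤N = c zero ℕ.⊔ N , λ
  { zero    → ℕₚ.m≤m⊔n (c zero) N
  ; (suc j) → ℕₚ.≤-trans (c≤N j) (ℕₚ.m≤n⊔m (c zero) N) }

-- A single minor involves finitely many columns. After as many steps as their largest index, all of
-- them consist of prescribed factors only.
columns⇒products : ∀ {m} {P : (Fin m → ℕ) → Set} (z : Fin m → ℚ) (g : ℕ → ℚ → ℚ) →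
  PositiveMinors P (Columns z []) →
  (∀ p gs → PositiveMinors P (Columns z gs) → PositiveMinors P (Columns z (gs ∷ʳ g p))) →
  PositiveMinors P (λ k i → ∏ g k (z i))
columns⇒products {P = P} z g base step c c-inc Pc with bounded c
... | N , c≤N = subst (0ℚ <_)
  (det-cong λ i j → column-applyUpTo g (z i) (c≤N j)) (iterate N c c-inc Pc)
  where
  iterate : ∀ p → PositiveMinors P (Columns z (applyUpTo g p))
  iterate zero    = base
  iterate (suc p) = subst (λ gs → PositiveMinors P (Columns z gs)) (applyUpTo-∷ʳ g p)
    (step p (applyUpTo g p) (iterate p))

-- Generalised Vandermonde determinants

-- Induction on the number of nodes. Taking the power with the least exponent `s` out of each row
-- makes the first exponent 0. Subtracting the least node then allows expansion along the first row,
-- and the remaining nodes are still positive and increasing.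
powers-positive : ∀ m (y : Fin m → ℚ) → (∀ i → 0ℚ < y i) → (∀ i j → i F.< j → y i < y j) →
  PositiveMinors (λ _ → ⊤) (Columns y [])
powers-positive zero    y 0<y y-inc c c-inc _ = positive⁻¹ 1ℚ
powers-positive (suc m) y 0<y y-inc c c-inc _ =
  subst (0ℚ <_) (sym (det-scaleRows (λ i → column [] s (y i)) factor))
    (positive-* (Πᶠ-positive λ i → pow-positive s (0<y i)) reduced)
  where
  open ≡-Reasoning
  s = c zero
  δ = y zero
  -- The first shifted node is 0, so without the exponent 0 its row would vanish. `pred` fixes 0, so
  -- this condition survives the replacements.
  P : (Fin (suc m) → ℕ) → Set
  P c = c zero ≡ 0
  w : Fin (suc m) → ℚ
  w i = y i - δ
  s≤c : ∀ j → s ℕ.≤ c j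
  s≤c zero    = ℕₚ.≤-refl
  s≤c (suc j) = ℕₚ.<⇒≤ (c-inc zero (suc j) (s≤s z≤n))
  pow-positive : ∀ k {x} → 0ℚ < x → 0ℚ < column [] k x
  pow-positive zero    0<x = positive⁻¹ 1ℚ
  pow-positive (suc k) 0<x = positive-* 0<x (pow-positive k 0<x)
  pow-+ : ∀ k l x → column [] (k ℕ.+ l) x ≡ column [] k x * column [] l x
  pow-+ zero    l x = sym (*-identityˡ _)
  pow-+ (suc k) l x = trans (cong (x *_) (pow-+ k l x)) (sym (*-assoc x _ _))
  factor : ∀ i j → column [] (c j) (y i) ≡ column [] s (y i) * column [] (c j ℕ.∸ s) (y i)
  factor i j = trans (cong (λ k → column [] k (y i)) (sym (ℕₚ.m+[n∸m]≡n (s≤c j))))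
    (pow-+ s (c j ℕ.∸ s) (y i))
  w+δ : ∀ i → w i + δ ≡ y i
  w+δ i = solve 2 (λ y d → (y :+ :- d) :+ d := y) refl (y i) δ
  w-mono : ∀ {i j} → y i < y j → w i < w j
  w-mono = +-monoˡ-< (- δ)
  shifted-base : PositiveMinors P (Columns w [])
  shifted-base d d-inc d₀≡0 = subst (0ℚ <_) (sym (det-firstRow {A = λ i j → column [] (d j) (w i)} first rest))
    (powers-positive m (w ∘ suc)
      (λ i → subst (_< w (suc i)) (+-inverseʳ δ) (w-mono (y-inc zero (suc i) (s≤s z≤n))))
      (λ i j i<j → w-mono (y-inc (suc i) (suc j) (s≤s i<j)))
      (d ∘ suc) (λ i j i<j → d-inc (suc i) (suc j) (s≤s i<j)) tt)
    where
    first : column [] (d zero) (w zero) ≡ 1ℚ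
    first = cong (λ k → column [] k (w zero)) d₀≡0
    rest : ∀ j → column [] (d (suc j)) (w zero) ≡ 0ℚ
    rest j with d (suc j) | d-inc zero (suc j) (s≤s z≤n)
    -- Strict increase excludes the exponent 0 here, and a positive power of the node 0 vanishes.
    ... | suc k | _ = trans (cong (_* column [] k (w zero)) (+-inverseʳ δ)) (*-zeroˡ (column [] k (w zero)))
  stable : Stable pred P
  stable choice c₀≡0 with choice zero
  ... | inj₁ eq = trans eq c₀≡0
  ... | inj₂ eq = trans eq (cong pred c₀≡0)
  ∏-shift : ∀ k i → ∏ (λ _ → _+ δ) k (w i) ≡ column [] k (y i)
  ∏-shift zero    i = refl
  ∏-shift (suc k) i = cong₂ _*_ (w+δ i) (∏-shift k i)
  reduced : 0ℚ < det (suc m) (λ i j → column [] (c j ℕ.∸ s) (y i))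
  reduced = subst (0ℚ <_) (det-cong λ i j → ∏-shift (c j ℕ.∸ s) i)
    (columns⇒products w (λ _ → _+ δ) shifted-base
      (λ p gs → combination-positive pred-interlacing stable
        (column-append w gs (<⇒≤ (0<y zero))))
      (λ j → c j ℕ.∸ s) (λ i j i<j → ℕₚ.∸-monoˡ-< (c-inc i j i<j) (s≤c i)) (ℕₚ.n∸n≡0 s))

-- Quadratic factors and column scaling

quadratic-products-positive : ∀ {m} (z : Fin m → ℚ) →
  (∀ i → 0ℚ < z i) → (∀ i j → i F.< j → z i < z j) →
  (a b : ℕ → ℚ) → (∀ p → 0ℚ ≤ a p) → (∀ p → 0ℚ < b p) →
  PositiveMinors (λ _ → ⊤) (λ k i → ∏ (λ p z → (z + a p) * (z + b p)) k (z i))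
quadratic-products-positive {m} z 0<z z-inc a b 0≤a 0<b =
  columns⇒products z (λ p z → (z + a p) * (z + b p)) (powers-positive m z 0<z z-inc)
    λ p gs → combination-positive suc-interlacing _ (column-extendLast z gs (_+ a p) (0<b p))
           ∘ combination-positive pred-interlacing _ (column-append z gs (0≤a p))

-- Division of columns by positive numbers is the degenerate combination with each column as its own
-- neighbour and `β` equal to 0.
unscaleColumns-positive : ∀ {m} {F G : ℕ → Fin m → ℚ} (e : ℕ → ℚ) → (∀ k → 0ℚ < e k) →
  (∀ k i → e k * G k i ≡ F k i) → PositiveMinors (λ _ → ⊤) F → PositiveMinors (λ _ → ⊤) G
unscaleColumns-positive {F = F} {G} e 0<e eG≡F =
  combination-positive {ν = λ k → k} id-interlacing _ λ k →
    let instance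
          e-pos : Positive (e k)
          e-pos = positive (0<e k)
          e-nz : NonZero (e k)
          e-nz = pos⇒nonZero (e k)
    in combine (1/ e k) 0ℚ (positive⁻¹ (1/ e k) {{1/pos⇒pos (e k)}}) ≤-refl λ i → begin
      G k i                        ≡⟨ *-identityˡ (G k i) ⟨
      1ℚ * G k i                   ≡⟨ cong (_* G k i) (*-inverseˡ (e k)) ⟨
      1/ e k * e k * G k i         ≡⟨ *-assoc (1/ e k) (e k) (G k i) ⟩
      1/ e k * (e k * G k i)       ≡⟨ cong (1/ e k *_) (eG≡F k i) ⟩
      1/ e k * F k i
        ≡⟨ solve 2 (λ u x → u :* x := u :* x :+ con 0ℚ :* x) refl (1/ e k) (F k i) ⟩
      1/ e k * F k i + 0ℚ * F k i  ∎
  where open ≡-Reasoning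

-- Natural numbers among the rationals

fromℕ : ℕ → ℚ
fromℕ n = + n / 1

fromℕ-+ : ∀ m n → fromℕ (m ℕ.+ n) ≡ fromℕ m + fromℕ n
fromℕ-+ m n = toℚᵘ-injective (begin
  toℚᵘ (fromℕ (m ℕ.+ n))               ≈⟨ toℚᵘ-fromℚᵘ (mkℚᵘ (+ (m ℕ.+ n)) 0) ⟩
  mkℚᵘ (+ (m ℕ.+ n)) 0
    ≡⟨ cong (λ i → mkℚᵘ i 0) (cong₂ ℤ._+_ (ℤₚ.*-identityʳ (+ m)) (ℤₚ.*-identityʳ (+ n))) ⟨
  mkℚᵘ (+ m) 0 ℚᵘ.+ mkℚᵘ (+ n) 0       ≈⟨ ℚᵘₚ.+-cong (toℚᵘ-fromℚᵘ (mkℚᵘ (+ m) 0)) (toℚᵘ-fromℚᵘ (mkℚᵘ (+ n) 0)) ⟨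
  toℚᵘ (fromℕ m) ℚᵘ.+ toℚᵘ (fromℕ n)   ≈⟨ toℚᵘ-homo-+ (fromℕ m) (fromℕ n) ⟨
  toℚᵘ (fromℕ m + fromℕ n)             ∎)
  where open ℚᵘₚ.≃-Reasoning

-- Clears the denominator of a matrix entry while an extra factor `e`, later the squared factorial,
-- stays in the numerator. The check runs on unnormalised fractions, where it is a
-- cross-multiplication.
*-/-cancel : ∀ d e x → fromℕ (suc d ℕ.* e) * (+ x / suc d) ≡ fromℕ (x ℕ.* e)
*-/-cancel d e x = toℚᵘ-injective (begin
  toℚᵘ (fromℕ (suc d ℕ.* e) * (+ x / suc d))
    ≈⟨ toℚᵘ-homo-* (fromℕ (suc d ℕ.* e)) (+ x / suc d) ⟩
  toℚᵘ (fromℕ (suc d ℕ.* e)) ℚᵘ.* toℚᵘ (+ x / suc d)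
    ≈⟨ ℚᵘₚ.*-cong (toℚᵘ-fromℚᵘ (mkℚᵘ (+ (suc d ℕ.* e)) 0)) (toℚᵘ-fromℚᵘ (mkℚᵘ (+ x) d)) ⟩
  mkℚᵘ (+ (suc d ℕ.* e)) 0 ℚᵘ.* mkℚᵘ (+ x) d
    ≈⟨ ℚᵘ.*≡* numerators ⟩
  mkℚᵘ (+ (x ℕ.* e)) 0
    ≈⟨ toℚᵘ-fromℚᵘ (mkℚᵘ (+ (x ℕ.* e)) 0) ⟨
  toℚᵘ (fromℕ (x ℕ.* e)) ∎)
  where
  open ℚᵘₚ.≃-Reasoning
  numerators : (+ (suc d ℕ.* e)) ℤ.* + x ℤ.* + 1 ≡ + (x ℕ.* e) ℤ.* + (1 ℕ.* suc d)
  numerators = trans (ℤₚ.*-identityʳ (+ (suc d ℕ.* e) ℤ.* + x))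
    (trans (sym (ℤₚ.pos-* (suc d ℕ.* e) x))
      (trans (cong +_ commute) (ℤₚ.pos-* (x ℕ.* e) (1 ℕ.* suc d))))
    where
    commute : suc d ℕ.* e ℕ.* x ≡ x ℕ.* e ℕ.* (1 ℕ.* suc d)
    commute = trans (ℕₚ.*-comm (suc d ℕ.* e) x) (trans
      (cong (x ℕ.*_) (trans (ℕₚ.*-comm (suc d) e) (cong (e ℕ.*_) (sym (ℕₚ.*-identityˡ (suc d))))))
      (sym (ℕₚ.*-assoc x e (1 ℕ.* suc d))))

fromℕ-* : ∀ m n → fromℕ (m ℕ.* n) ≡ fromℕ m * fromℕ n
fromℕ-* m n = sym (trans (cong (λ k → fromℕ k * fromℕ n) (sym (ℕₚ.*-identityˡ m)))
  (trans (*-/-cancel 0 m n) (cong fromℕ (ℕₚ.*-comm n m))))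

fromℕ-positive : ∀ n .{{_ : ℕ.NonZero n}} → 0ℚ < fromℕ n
fromℕ-positive n = positive⁻¹ (fromℕ n) {{normalize-pos n 1}}

fromℕ-nonNegative : ∀ n → 0ℚ ≤ fromℕ n
fromℕ-nonNegative n = nonNegative⁻¹ (fromℕ n) {{normalize-nonNeg n 1}}

fromℕ-mono-< : ∀ {m n} → m ℕ.< n → fromℕ m < fromℕ n
fromℕ-mono-< {m} {n} m<n = subst₂ _<_ (+-identityʳ (fromℕ m))
  (trans (sym (fromℕ-+ m (n ℕ.∸ m))) (cong fromℕ (ℕₚ.m+[n∸m]≡n (ℕₚ.<⇒≤ m<n))))
  (+-monoʳ-< (fromℕ m) (fromℕ-positive (n ℕ.∸ m) {{ℕ.>-nonZero (ℕₚ.m<n⇒0<n∸m m<n)}}))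

-- Rising factorials and binomial coefficients

-- The Pochhammer symbol of n+1, that is (n+1)(n+2)⋯(n+k). It is unfolded from its smallest factor
-- to match the recursion of `∏`.
rising : ℕ → ℕ → ℕ
rising n zero    = 1
rising n (suc k) = suc n ℕ.* rising (suc n) k

rising-! : ∀ n k → rising n k ℕ.* n ! ≡ (n ℕ.+ k) !
rising-! n zero    = trans (ℕₚ.+-identityʳ (n !)) (cong _! (sym (ℕₚ.+-identityʳ n)))
rising-! n (suc k) = begin
  suc n ℕ.* rising (suc n) k ℕ.* n !   ≡⟨ cong (ℕ._* n !) (ℕₚ.*-comm (suc n) (rising (suc n) k)) ⟩
  rising (suc n) k ℕ.* suc n ℕ.* n !   ≡⟨ ℕₚ.*-assoc (rising (suc n) k) (suc n) (n !) ⟩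
  rising (suc n) k ℕ.* (suc n) !       ≡⟨ rising-! (suc n) k ⟩
  (suc n ℕ.+ k) !                      ≡⟨ cong _! (ℕₚ.+-suc n k) ⟨
  (n ℕ.+ suc k) !                      ∎
  where open ≡-Reasoning

C-rising : ∀ n k → ((n ℕ.+ k) C k) ℕ.* k ! ≡ rising n k
C-rising n k = ℕₚ.*-cancelʳ-≡ _ _ (n !) {{ℕₚ._!≢0 n}} (begin
  ((n ℕ.+ k) C k) ℕ.* k ! ℕ.* n !         ≡⟨ ℕₚ.*-assoc ((n ℕ.+ k) C k) (k !) (n !) ⟩
  ((n ℕ.+ k) C k) ℕ.* (k ! ℕ.* n !)
    ≡⟨ cong (λ l → ((n ℕ.+ k) C k) ℕ.* (k ! ℕ.* l !)) (ℕₚ.m+n∸n≡m n k) ⟨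
  ((n ℕ.+ k) C k) ℕ.* (k ! ℕ.* (n ℕ.+ k ℕ.∸ k) !)
    ≡⟨ cong (ℕ._* (k ! ℕ.* (n ℕ.+ k ℕ.∸ k) !)) (nCk≡n!/k![n-k]! k≤n+k) ⟩
  ((n ℕ.+ k) ! ℕ./ (k ! ℕ.* (n ℕ.+ k ℕ.∸ k) !)) ℕ.* (k ! ℕ.* (n ℕ.+ k ℕ.∸ k) !)
    ≡⟨ m/n*n≡m (k![n∸k]!∣n! k≤n+k) ⟩
  (n ℕ.+ k) !                             ≡⟨ rising-! n k ⟨
  rising n k ℕ.* n !                      ∎)
  where
  open ≡-Reasoning
  k≤n+k : k ℕ.≤ n ℕ.+ k
  k≤n+k = ℕₚ.m≤n+m k n
  instance
    k![n+k-k]!≢0 : ℕ.NonZero (k ! ℕ.* (n ℕ.+ k ℕ.∸ k) !)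
    k![n+k-k]!≢0 = ℕₚ._!*_!≢0 k (n ℕ.+ k ℕ.∸ k)

∏-rising : ∀ g n n′ k z → (∀ q → g q z ≡ fromℕ (suc (n ℕ.+ q)) * fromℕ (suc (n′ ℕ.+ q))) →
  ∏ g k z ≡ fromℕ (rising n k ℕ.* rising n′ k)
∏-rising g n n′ zero    z eq = refl
∏-rising g n n′ (suc k) z eq = begin
  g 0 z * ∏ (g ∘ suc) k z
    ≡⟨ cong₂ _*_ (trans (eq 0) (cong₂ factors (ℕₚ.+-identityʳ n) (ℕₚ.+-identityʳ n′)))
        (∏-rising (g ∘ suc) (suc n) (suc n′) k z λ q →
          trans (eq (suc q)) (cong₂ factors (ℕₚ.+-suc n q) (ℕₚ.+-suc n′ q))) ⟩
  fromℕ (suc n) * fromℕ (suc n′) * fromℕ (rising (suc n) k ℕ.* rising (suc n′) k)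
    ≡⟨ cong (_* fromℕ (rising (suc n) k ℕ.* rising (suc n′) k)) (fromℕ-* (suc n) (suc n′)) ⟨
  fromℕ (suc n ℕ.* suc n′) * fromℕ (rising (suc n) k ℕ.* rising (suc n′) k)
    ≡⟨ fromℕ-* (suc n ℕ.* suc n′) (rising (suc n) k ℕ.* rising (suc n′) k) ⟨
  fromℕ (suc n ℕ.* suc n′ ℕ.* (rising (suc n) k ℕ.* rising (suc n′) k))
    ≡⟨ cong fromℕ (ℕₚ.[m*n]*[o*p]≡[m*o]*[n*p] (suc n) (suc n′) (rising (suc n) k) (rising (suc n′) k)) ⟩
  fromℕ (rising n (suc k) ℕ.* rising n′ (suc k)) ∎
  where
  open ≡-Reasoning
  factors : ℕ → ℕ → ℚ
  factors u v = fromℕ (suc u) * fromℕ (suc v)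

-- With the nodes n + ½ every shift q + s + ½ is positive, even for q = s = 0.
rising-products-positive : ∀ s {m} (r : Fin m → ℕ) → StrictlyIncreasing r →
  PositiveMinors (λ _ → ⊤) (λ k i → fromℕ (rising (s ℕ.+ r i) k ℕ.* rising (r i) k))
rising-products-positive s r r-inc c c-inc _ = subst (0ℚ <_)
  (det-cong λ i j → ∏-rising _ (s ℕ.+ r i) (r i) (c j) (fromℕ (r i) + ½) λ q →
    cong₂ _*_ (factor₁ (r i) q) (factor₀ (r i) q))
  (quadratic-products-positive (λ i → fromℕ (r i) + ½) (λ i → 0<n+½ (r i))
    (λ i j i<j → +-monoˡ-< ½ (fromℕ-mono-< (r-inc i j i<j)))
    (λ q → fromℕ (s ℕ.+ q) + ½) (λ q → fromℕ q + ½)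
    (λ q → <⇒≤ (0<n+½ (s ℕ.+ q))) 0<n+½ c c-inc tt)
  where
  0<n+½ : ∀ n → 0ℚ < fromℕ n + ½
  0<n+½ n = +-mono-≤-< (fromℕ-nonNegative n) (positive⁻¹ ½)
  factor₀ : ∀ n q → (fromℕ n + ½) + (fromℕ q + ½) ≡ fromℕ (suc (n ℕ.+ q))
  factor₀ n q = trans
    (solve 2 (λ x y → (x :+ con ½) :+ (y :+ con ½) := con 1ℚ :+ (x :+ y)) refl (fromℕ n) (fromℕ q))
    (trans (cong (λ x → 1ℚ + x) (sym (fromℕ-+ n q))) (sym (fromℕ-+ 1 (n ℕ.+ q))))
  factor₁ : ∀ n q → (fromℕ n + ½) + (fromℕ (s ℕ.+ q) + ½) ≡ fromℕ (suc (s ℕ.+ n ℕ.+ q))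
  factor₁ n q = trans (factor₀ n (s ℕ.+ q)) (cong (fromℕ ∘ suc) (begin
    n ℕ.+ (s ℕ.+ q) ≡⟨ ℕₚ.+-assoc n s q ⟨
    n ℕ.+ s ℕ.+ q   ≡⟨ cong (ℕ._+ q) (ℕₚ.+-comm n s) ⟩
    s ℕ.+ n ℕ.+ q   ∎))
    where open ≡-Reasoning

-- The matrices of types A and B

-- Multiplying column `k` by `suc (d k)` and the square of `k !` clears the denominator and turns
-- both binomials into rising factorials. The shift `s` covers both types at once.
binomial-products-positive : ∀ s (d : ℕ → ℕ) → StrictlyTotallyPositive
  (λ n k → + (((s ℕ.+ n ℕ.+ k) C k) ℕ.* ((n ℕ.+ k) C k)) / suc (d k))
binomial-products-positive s d m r c r-inc c-inc =
  unscaleColumns-positive (λ k → fromℕ (suc (d k) ℕ.* (k ! ℕ.* k !)))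
    (λ k → fromℕ-positive (suc (d k) ℕ.* (k ! ℕ.* k !))
      {{ℕₚ.m*n≢0 (suc (d k)) (k ! ℕ.* k !) {{_}} {{ℕₚ._!*_!≢0 k k}}}})
    (λ k i → trans
      (*-/-cancel (d k) (k ! ℕ.* k !) (((s ℕ.+ r i ℕ.+ k) C k) ℕ.* ((r i ℕ.+ k) C k)))
      (cong fromℕ (trans
        (ℕₚ.[m*n]*[o*p]≡[m*o]*[n*p] ((s ℕ.+ r i ℕ.+ k) C k) ((r i ℕ.+ k) C k) (k !) (k !))
        (cong₂ ℕ._*_ (C-rising (s ℕ.+ r i) k) (C-rising (r i) k)))))
    (rising-products-positive s r r-inc) c c-inc tt

theorem3p2 : StrictlyTotallyPositive NAsq × StrictlyTotallyPositive NBsq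
-- Type A has upper index n+k+1 in one binomial and denominator k+1; type B has two equal binomials
-- and denominator 1.
theorem3p2 = binomial-products-positive 1 (λ k → k) , binomial-products-positive 0 (λ _ → 0)
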